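{- Let $G$ and $H$ be graphs with $a(G)<a(H)$. Then for all integers $q\geq 2$, $G$ and $H$ are not $q$-Ramsey equivalent.
   Context: Graphs are finite and simple, with at least one vertex. $\chi(G)$ denotes the chromatic number of $G$. A proper vertex colouring is one in which no two adjacent vertices receive the same colour. For a graph $G$, $a(G)$ is the minimum number of vertices which can be given colour $1$ in a proper vertex colouring of $G$ in colours $1,\ldots,\chi(G)$. For an integer $q\geq 2$ and graphs $F$ and $G$, $F\rightarrow (G)_q$ ("$F$ is $q$-Ramsey for $G$") means that every colouring of the edges of $F$ in $q$ colours contains a monochromatic copy of $G$, that is, a (not necessarily induced) subgraph of $F$ isomorphic to $G$ all of whose edges have the same colour. Two graphs $H_1$ and $H_2$ are $q$-Ramsey equivalent if for all graphs $F$, $F\rightarrow (H_1)_q$ if and only if $F\rightarrow (H_2)_q$. -}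

module Defs where

open import Data.Fin using (Fin; toℕ)
open import Data.Fin.Properties using (any?; all?) renaming (_≟_ to _≟ᶠ_)
open import Data.Nat using (ℕ; zero; suc; _≤_; z≤n; s≤s; NonZero; _≟_)
open import Data.Product using (∃; ∃-syntax; Σ-syntax; _×_; _,_; proj₁; proj₂)
open import Data.Vec using (Vec; []; _∷_; allFin; count; lookup; tabulate)
open import Data.Vec.Properties using (lookup∘tabulate)
open import Function using (_∘_; _⇔_; id)
open import Function.Definitions using (Injective)
open import Level using (0ℓ)
open import Relation.Binary using (Rel; Decidable; Symmetric; Irreflexive)
open import Relation.Binary.PropositionalEquality
  using (_≡_; _≢_; _≗_; refl; sym; trans; cong)
open import Relation.Nullary using (Dec; yes; no; contradiction)
open import Relation.Nullary.Decidable using (map′; ¬?; _→-dec_; _×-dec_)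
open import Relation.Unary using (Pred) renaming (Decidable to Decidable₁)

record Graph : Set₁ where
  infix 4 _~_
  field
    order       : ℕ
    {{nonEmpty}} : NonZero order

  Vertex : Set
  Vertex = Fin order

  field
    _~_     : Rel Vertex 0ℓ
    _~?_    : Decidable _~_
    ~-sym   : Symmetric _~_
    ~-irrefl : Irreflexive _≡_ _~_

open Graph public using (order; Vertex)

IsLeast : Pred ℕ 0ℓ → ℕ → Set
IsLeast P m = P m × (∀ k → P k → m ≤ k)

least : {P : Pred ℕ 0ℓ} → Decidable₁ P → ∀ n → P n → ∃ (IsLeast P)
least P? n pn with P? 0
least P? n       pn | yes p₀ = 0 , p₀ , λ _ _ → z≤n
least P? zero    p₀ | no ¬p₀ = contradiction p₀ ¬p₀
least P? (suc n) pn | no ¬p₀ with least (P? ∘ suc) n pn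
... | m , pm , min = suc m , pm , λ where
  zero    p₀ → contradiction p₀ ¬p₀
  (suc k) pk → s≤s (min k pk)

anyVec? : ∀ {k} n {P : Pred (Vec (Fin k) n) 0ℓ} → Decidable₁ P → Dec (∃ P)
anyVec? zero P? = map′ (λ p → [] , p) (λ { ([] , p) → p }) (P? [])
anyVec? (suc n) P? =
  map′ (λ { (i , v , p) → (i ∷ v) , p }) (λ { ((i ∷ v) , p) → i , v , p })
       (any? λ i → anyVec? n (λ v → P? (i ∷ v)))

anyFun? : ∀ {n k} {P : Pred (Fin n → Fin k) 0ℓ} →
          (∀ {f g} → f ≗ g → P f → P g) → Decidable₁ P → Dec (∃ P)
anyFun? {n} resp P? =
  map′ (λ { (v , p) → lookup v , p })
       (λ { (f , p) → tabulate f , resp (sym ∘ lookup∘tabulate f) p })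
       (anyVec? n (P? ∘ lookup))

module _ (G : Graph) where
  open Graph G using (_~_; _~?_; ~-irrefl)

  Proper : ∀ {k} → Pred (Vertex G → Fin k) 0ℓ
  Proper f = ∀ u v → u ~ v → f u ≢ f v

  Colourable : Pred ℕ 0ℓ
  Colourable k = ∃[ f ] Proper {k} f

  proper-resp : ∀ {k} {f g : Vertex G → Fin k} → f ≗ g → Proper f → Proper g
  proper-resp f≗g p u v e gu≡gv =
    p u v e (trans (f≗g u) (trans gu≡gv (sym (f≗g v))))

  proper? : ∀ {k} → Decidable₁ (Proper {k})
  proper? f = all? λ u → all? λ v → (u ~? v) →-dec ¬? (f u ≟ᶠ f v)

  colourable? : Decidable₁ Colourable
  colourable? k = anyFun? proper-resp proper?

  chromatic : ∃ (IsLeast Colourable)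
  chromatic = least colourable? (order G) (id , λ u v e u≡v → ~-irrefl u≡v e)

  χ : ℕ
  χ = proj₁ chromatic

  -- The colours 1, …, k are the elements of Fin k in order, so colour 1 is
  -- the element with toℕ equal to 0; it exists for k = χ, as G has a vertex.
  #colour₁ : ∀ {k} → (Vertex G → Fin k) → ℕ
  #colour₁ f = count (λ v → toℕ (f v) ≟ 0) (allFin (order G))

  ColourClassSize : Pred ℕ 0ℓ
  ColourClassSize m = Σ[ f ∈ (Vertex G → Fin χ) ] (Proper f × #colour₁ f ≡ m)

  #colour₁-cong : ∀ {k} {f g : Vertex G → Fin k} → f ≗ g →
                  #colour₁ f ≡ #colour₁ g
  #colour₁-cong {f = f} {g} f≗g = go (allFin (order G))
    where
    go : ∀ {n} (vs : Vec (Vertex G) n) →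
         count (λ v → toℕ (f v) ≟ 0) vs ≡ count (λ v → toℕ (g v) ≟ 0) vs
    go [] = refl
    go (v ∷ vs) rewrite f≗g v | go vs = refl

  colourClassSize? : Decidable₁ ColourClassSize
  colourClassSize? m = anyFun?
    (λ f≗g (p , eq) → proper-resp f≗g p , trans (sym (#colour₁-cong f≗g)) eq)
    (λ f → proper? f ×-dec (#colour₁ f ≟ m))

  smallestClass : ∃ (IsLeast ColourClassSize)
  smallestClass with proj₁ (proj₂ chromatic)
  ... | f , p = least colourClassSize? (#colour₁ f) (f , p , refl)

  a : ℕ
  a = proj₁ smallestClass

-- By unoriented, the colour depends only on the unordered pair {u , v}, and
-- not on the proof of adjacency.
record EdgeColouring (F : Graph) (q : ℕ) : Set where
  open Graph F using (_~_)
  field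
    colour     : ∀ {u v} → u ~ v → Fin q
    unoriented : ∀ {u v} (e : u ~ v) (e′ : v ~ u) → colour e ≡ colour e′

-- An isomorphism from G onto a subgraph of F, not necessarily induced.
record Copy (G F : Graph) : Set where
  private
    module G = Graph G
    module F = Graph F
  field
    vertex    : Vertex G → Vertex F
    injective : Injective _≡_ _≡_ vertex
    edge      : ∀ {u v} → u G.~ v → vertex u F.~ vertex v

module _ {G F : Graph} {q : ℕ} where
  open Graph G using (_~_)

  Monochromatic : EdgeColouring F q → Copy G F → Set
  Monochromatic c κ =
    ∃[ i ] (∀ {u v} (e : u ~ v) → EdgeColouring.colour c (Copy.edge κ e) ≡ i)

infix 4 _⟶⟨_⟩_

_⟶⟨_⟩_ : Graph → ℕ → Graph → Set
F ⟶⟨ q ⟩ G = (c : EdgeColouring F q) → ∃[ κ ] Monochromatic {G} c κ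

RamseyEquivalent : ℕ → Graph → Graph → Set₁
RamseyEquivalent q H₁ H₂ = ∀ F → F ⟶⟨ q ⟩ H₁ ⇔ F ⟶⟨ q ⟩ H₂

{-# OPTIONS --safe #-}
module Submission where

open import Axiom.UniquenessOfIdentityProofs using (module Decidable⇒UIP)
open import Data.Empty using (⊥)
open import Data.Fin
  using (Fin; zero; suc; toℕ; cast; inject₁; inject≤; finToFun; funToFin; punchOut; remQuot; combine)
  renaming (_≤_ to _≤ᶠ_)
import Data.Fin.Permutation.Components as PC
open import Data.Fin.Properties as Fin
  using (any?; all?; +↔⊎; *↔×; toℕ-injective; toℕ-cast; suc-injective; inject₁-injective;
         inject≤-injective; punchOut-injective; injective⇒≤; finToFun-funToFin; remQuot-combine;
         combine-remQuot; nonZeroIndex)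
  renaming (_≟_ to _≟ᶠ_; _≤?_ to _≤?ᶠ_)
open import Data.List as List using (List; []; _∷_; length)
open import Data.List.Membership.Propositional using (_∈_)
open import Data.List.Membership.Propositional.Properties using (∈-map⁺; ∈-allFin; ∈-tabulate⁺)
open import Data.List.Properties using (length-map; length-tabulate)
open import Data.List.Relation.Unary.Any as Any using (here; there)
open import Data.Nat using (ℕ; zero; suc; pred; _+_; _*_; _^_; _≤_; _<_; _≤?_; _≟_; z≤n; s≤s)
open import Data.Nat.Properties as ℕ using (≤-trans; ≤-refl; ≤-reflexive)
open import Data.Product using (Σ; Σ-syntax; ∃; ∃-syntax; _×_; _,_; proj₁; proj₂)
open import Data.Product.Function.NonDependent.Propositional using (_×-↔_)
open import Data.Product.Properties using (,-injectiveʳ-UIP)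
open import Data.Sum using (_⊎_; inj₁; inj₂)
open import Data.Sum.Function.Propositional using (_⊎-↔_)
open import Data.Sum.Properties using (inj₁-injective; inj₂-injective)
open import Data.Unit using (⊤; tt)
open import Data.Vec using (Vec; []; _∷_; count; allFin; tabulate)
open import Data.Vec.Functional using (updateAt)
open import Data.Vec.Functional.Properties using (updateAt-updates; updateAt-minimal)
open import Function using (_∘_; id; _↔_; Inverse; Equivalence; mk↔ₛ′)
open import Function.Definitions using (Injective)
open import Function.Properties.Inverse using (↔-refl; ↔-sym; ↔-trans)
open import Relation.Binary using (DecidableEquality; Tri; tri<; tri≈; tri>)
open import Relation.Binary.PropositionalEquality
  using (_≡_; _≢_; refl; sym; trans; cong; cong₂; subst; subst₂)
open import Relation.Nullary using (Dec; yes; no; ¬_; contradiction)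
open import Relation.Nullary.Decidable using (map′; ¬?; dec-true; _×-dec_; _→-dec_)
open import Relation.Unary using (Decidable)
open import Defs

-- If χ G < χ H, there is an F → G with an edge colouring in which all small
-- subgraphs of a colour class are χ G-colourable, so that none contains H, and
-- symmetrically if χ H < χ G.  If χ G = χ H = r, there is an
-- F → G with a vertex set U of size q (a G − 1) + 1 and an edge colouring in
-- which every small subgraph of a colour class becomes (r − 1)-colourable after
-- deleting at most a G vertices of U; a monochromatic H would then have an
-- r-colouring with at most a G < a H vertices of colour 1.
--
-- Both come from one induction, on the sum of the sizes r_i, producing X such
-- that every colouring of X has a complete r_i-partite graph with large parts in
-- some colour i, whereas X is covered by layers, the i-th locally
-- (r_i − 1)-colourable, except for one layer j of choice, which is only locally
-- r_j-colourable.  For the step take X_j for the sizes with r_j decreased by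
-- one, place copies of all the X_j on the edges of a sparse vertex-Ramsey
-- hypergraph, and join the result B completely to a set U.  A colouring assigns
-- to a vertex of B its vector of colours to U; in copies of the X_j with
-- constant vector, many vertices of U have the same colour i to everything, and
-- X_i provides either a required monochromatic graph or a complete
-- (r_i − 1)-partite graph of colour i, which these vertices of U extend.
-- Putting the edges at U into layer j raises only the chromatic number of
-- layer j.

-- Counting

module _ {A : Set} {P : A → Set} (P? : Decidable P) where
  count-complement : ∀ {n} (xs : Vec A n) → count P? xs + count (¬? ∘ P?) xs ≡ n
  count-complement [] = refl
  count-complement (x ∷ xs) with P? x
  ... | yes _ = cong suc (count-complement xs)
  ... | no  _ = trans (ℕ.+-suc _ _) (cong suc (count-complement xs))

  enumerate : ∀ {n} (f : Fin n → A) →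
    Σ[ e ∈ (Fin (count P? (tabulate f)) → Fin n) ] (Injective _≡_ _≡_ e × ∀ x → P (f (e x)))
  enumerate {zero} f = (λ ()) , (λ { {()} }) , λ ()
  enumerate {suc n} f with P? (f zero) | enumerate (f ∘ suc)
  ... | no  _ | e , inj , sat = suc ∘ e , inj ∘ suc-injective , sat
  ... | yes p | e , inj , sat = e⁺ , inj⁺ , sat⁺
    where
    e⁺ : Fin (suc (count P? (tabulate (f ∘ suc)))) → Fin (suc n)
    e⁺ zero    = zero
    e⁺ (suc x) = suc (e x)
    inj⁺ : Injective _≡_ _≡_ e⁺
    inj⁺ {zero}  {zero}  _  = refl
    inj⁺ {suc x} {suc y} eq = cong suc (inj (suc-injective eq))
    sat⁺ : ∀ x → P (f (e⁺ x))
    sat⁺ zero    = p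
    sat⁺ (suc x) = sat x

  rank : ∀ {n} (f : Fin n → A) →
    Σ[ r ∈ (∀ x → P (f x) → Fin (count P? (tabulate f))) ]
      (∀ {x y} p p′ → r x p ≡ r y p′ → x ≡ y)
  rank {zero} f = (λ ()) , λ { {()} }
  rank {suc n} f with P? (f zero) | rank (f ∘ suc)
  ... | no ¬p | r , inj = r⁺ , inj⁺
    where
    r⁺ : ∀ x → P (f x) → Fin (count P? (tabulate (f ∘ suc)))
    r⁺ zero    p = contradiction p ¬p
    r⁺ (suc x) p = r x p
    inj⁺ : ∀ {x y} p p′ → r⁺ x p ≡ r⁺ y p′ → x ≡ y
    inj⁺ {zero}          p p′ _  = contradiction p ¬p
    inj⁺ {suc x} {zero}  p p′ _  = contradiction p′ ¬p
    inj⁺ {suc x} {suc y} p p′ eq = cong suc (inj p p′ eq)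
  ... | yes _ | r , inj = r⁺ , inj⁺
    where
    r⁺ : ∀ x → P (f x) → Fin (suc (count P? (tabulate (f ∘ suc))))
    r⁺ zero    p = zero
    r⁺ (suc x) p = suc (r x p)
    inj⁺ : ∀ {x y} p p′ → r⁺ x p ≡ r⁺ y p′ → x ≡ y
    inj⁺ {zero}  {zero}  p p′ _  = refl
    inj⁺ {suc x} {suc y} p p′ eq = cong suc (inj p p′ (suc-injective eq))

  count-≤ : ∀ {n s} (r : ∀ x → P x → Fin s) → (∀ {x y} p p′ → r x p ≡ r y p′ → x ≡ y) →
    (f : Fin n → A) → Injective _≡_ _≡_ f → count P? (tabulate f) ≤ s
  count-≤ r r-inj f f-inj with enumerate f
  ... | e , inj , sat = injective⇒≤ {f = λ x → r (f (e x)) (sat x)} (inj ∘ f-inj ∘ r-inj _ _)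

record Fibre {A : Set} {t : ℕ} (f : A → Fin t) (m : ℕ) : Set where
  constructor fibre
  field
    value     : Fin t
    member    : Fin m → A
    injective : Injective _≡_ _≡_ member
    constant  : ∀ x → f (member x) ≡ value

-- Either the value `zero` is taken more than `m` times, or discarding its at most `m` preimages
-- leaves enough indices for the remaining values.
pigeonhole : ∀ t {m n} → t * m < n → (f : Fin n → Fin t) → Fibre f (suc m)
pigeonhole zero {n = suc _} _ f with () ← f zero
pigeonhole (suc t) {m} {n} lt f
  with suc m ≤? count (λ x → f x ≟ᶠ zero) (allFin n)
... | yes le with enumerate (λ x → f x ≟ᶠ zero) id
...   | e , inj , sat = fibre zero (λ x → e (inject≤ x le)) (inject≤-injective le le _ _ ∘ inj) (λ x → sat (inject≤ x le))
pigeonhole (suc t) {m} {n} lt f | no ≰ with enumerate (λ x → ¬? (f x ≟ᶠ zero)) id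
... | e , inj , sat
  with pigeonhole t lt′ (λ x → punchOut (sat x ∘ sym))
  where
  few : count (λ x → f x ≟ᶠ zero) (allFin n) ≤ m
  few = ℕ.≤-pred (ℕ.≰⇒> ≰)
  lt′ : t * m < count (λ x → ¬? (f x ≟ᶠ zero)) (allFin n)
  lt′ = ℕ.+-cancelˡ-< m _ _ (ℕ.<-≤-trans lt
    (≤-trans (≤-reflexive (sym (count-complement (λ x → f x ≟ᶠ zero) (allFin n)))) (ℕ.+-monoˡ-≤ _ few)))
... | fibre i ι ι-inj const = fibre (suc i) (e ∘ ι) (ι-inj ∘ inj) (λ x → lift (f (e (ι x))) _ (const x))
  where
  lift : ∀ {n} (y : Fin (suc n)) {i} (≢ : zero ≢ y) → punchOut ≢ ≡ i → y ≡ suc i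
  lift zero    ≢ _    = contradiction refl ≢
  lift (suc y) ≢ refl = refl

-- Finite types

Finite : Set → Set
Finite A = ∃[ n ] (A ↔ Fin n)

module Enumeration {A : Set} (fin : Finite A) where
  size : ℕ
  size = proj₁ fin

  index : A → Fin size
  index = Inverse.to (proj₂ fin)

  element : Fin size → A
  element = Inverse.from (proj₂ fin)

  element-index : ∀ x → element (index x) ≡ x
  element-index = Inverse.strictlyInverseʳ (proj₂ fin)

  index-element : ∀ i → index (element i) ≡ i
  index-element = Inverse.strictlyInverseˡ (proj₂ fin)

  index-injective : Injective _≡_ _≡_ index
  index-injective {x} {y} eq =
    trans (sym (element-index x)) (trans (cong element eq) (element-index y))

  element-injective : Injective _≡_ _≡_ element
  element-injective {i} {j} eq =
    trans (sym (index-element i)) (trans (cong index eq) (index-element j))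

  _≡?_ : DecidableEquality A
  x ≡? y = map′ index-injective (cong index) (index x ≟ᶠ index y)

  exists? : {P : A → Set} → Decidable P → Dec (∃ P)
  exists? {P} P? = map′
    (λ (i , p) → element i , p)
    (λ (x , p) → index x , subst P (sym (element-index x)) p)
    (any? (P? ∘ element))

finite-Fin : ∀ n → Finite (Fin n)
finite-Fin n = n , ↔-refl

finite-⊎ : ∀ {A B} → Finite A → Finite B → Finite (A ⊎ B)
finite-⊎ (m , A↔) (n , B↔) = m + n , ↔-trans (A↔ ⊎-↔ B↔) (↔-sym +↔⊎)

finite-× : ∀ {A B} → Finite A → Finite B → Finite (A × B)
finite-× (m , A↔) (n , B↔) = m * n , ↔-trans (A↔ ×-↔ B↔) (↔-sym *↔×)

finite-⊤ : Finite ⊤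
finite-⊤ = 1 , ↔-sym Fin.1↔⊤

finite-Σ : ∀ q {A : Fin q → Set} → (∀ j → Finite (A j)) → Finite (Σ (Fin q) A)
finite-Σ zero fin = 0 , mk↔ₛ′ proj₁ (λ ()) (λ ()) λ ()
finite-Σ (suc q) {A} fin =
  let n , A↔ = finite-⊎ (fin zero) (finite-Σ q (fin ∘ suc))
  in n , ↔-trans split A↔
  where
  split : Σ (Fin (suc q)) A ↔ (A zero ⊎ Σ (Fin q) (A ∘ suc))
  split = mk↔ₛ′
    (λ { (zero , x) → inj₁ x ; (suc j , x) → inj₂ (j , x) })
    (λ { (inj₁ x) → zero , x ; (inj₂ (j , x)) → suc j , x })
    (λ { (inj₁ x) → refl ; (inj₂ _) → refl })
    (λ { (zero , x) → refl ; (suc j , x) → refl })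

-- Sparse vertex-Ramsey hypergraphs

record Hypergraph (I : Set) : Set₁ where
  field
    V E   : Set
    finV  : Finite V
    finE  : Finite E
    inc   : E → I → V

module _ {I : Set} (H : Hypergraph I) where
  open Hypergraph H

  -- Sparsity, in the form in which it is used: colourings of at most h edges
  -- can be glued after permuting the colours on each edge.
  Gluing : ℕ → Set
  Gluing h = ∀ {k} (φ : E → I → Fin (suc k)) (l : List E) → length l ≤ h →
    Σ[ g ∈ (V → Fin (suc k)) ] (∀ e → e ∈ l →
      Σ[ σ ∈ (Fin (suc k) → Fin (suc k)) ]
        (Injective _≡_ _≡_ σ × (∀ i → g (inc e i) ≡ σ (φ e i))))

  VertexRamsey : ℕ → Set
  VertexRamsey t = (c : V → Fin t) → Σ[ e ∈ E ] ∃[ γ ] (∀ i → c (inc e i) ≡ γ)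

  Transversal : ∀ {p} → (V → Fin p) → Set
  Transversal part = ∀ e → Injective _≡_ _≡_ (part ∘ inc e)

transpose-matches : ∀ {n} (i j : Fin n) → PC.transpose i j i ≡ j
transpose-matches i j rewrite dec-true (i ≟ᶠ i) refl = refl

-- An entry is kept exactly when it occurs again later, so the last entry always goes, and whatever
-- is missing from the result occurs at most once in the list.
repeats : {A : Set} → DecidableEquality A → List A → List A
repeats _≡?_ [] = []
repeats _≡?_ (x ∷ xs) with Any.any? (x ≡?_) xs
... | yes _ = x ∷ repeats _≡?_ xs
... | no  _ = repeats _≡?_ xs

module _ {A : Set} (_≡?_ : DecidableEquality A) where
  length-repeats : ∀ xs → length (repeats _≡?_ xs) ≤ length xs
  length-repeats [] = z≤n
  length-repeats (x ∷ xs) with Any.any? (x ≡?_) xs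
  ... | yes _ = s≤s (length-repeats xs)
  ... | no  _ = ℕ.m≤n⇒m≤1+n (length-repeats xs)

  length-repeats-< : ∀ {h} xs → length xs ≤ suc h → length (repeats _≡?_ xs) ≤ h
  length-repeats-< [] _ = z≤n
  length-repeats-< (x ∷ xs) le with Any.any? (x ≡?_) xs
  length-repeats-< (x ∷ []) _ | yes ()
  length-repeats-< {suc h} (x ∷ xs@(_ ∷ _)) (s≤s le) | yes _ = s≤s (length-repeats-< xs le)
  ... | no _ = ≤-trans (length-repeats xs) (ℕ.≤-pred le)

  repeats-unique : {B : Set} (f : B → A) (l : List B) → ∀ {x y} → x ∈ l → y ∈ l →
    f x ≡ f y → ¬ (f x ∈ repeats _≡?_ (List.map f l)) → x ≡ y
  repeats-unique f (z ∷ l) x∈ y∈ eq ∉ with Any.any? (f z ≡?_) (List.map f l)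
  repeats-unique f (z ∷ l) (here refl) (here refl) eq ∉ | _ = refl
  repeats-unique f (z ∷ l) (here refl) (there y∈) eq ∉ | yes _ = contradiction (here refl) ∉
  repeats-unique f (z ∷ l) (there x∈) (here refl) eq ∉ | yes _ = contradiction (here eq) ∉
  repeats-unique f (z ∷ l) (there x∈) (there y∈) eq ∉ | yes _ =
    repeats-unique f l x∈ y∈ eq (∉ ∘ there)
  repeats-unique f (z ∷ l) (here refl) (there y∈) eq ∉ | no ¬∈ =
    contradiction (subst (_∈ List.map f l) (sym eq) (∈-map⁺ f y∈)) ¬∈
  repeats-unique f (z ∷ l) (there x∈) (here refl) eq ∉ | no ¬∈ =
    contradiction (subst (_∈ List.map f l) eq (∈-map⁺ f x∈)) ¬∈
  repeats-unique f (z ∷ l) (there x∈) (there y∈) eq ∉ | no _ = repeats-unique f l x∈ y∈ eq ∉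

-- One copy of P for every edge of Q, glued along the part j by means of the
-- vertices of Q.  The vertices inj₂ (_ , v) with v in part j lie on no edge.
module Amalgam {I : Set} (P : Hypergraph I) {p : ℕ}
  (part : Hypergraph.V P → Fin p) (transversal : Transversal P part)
  (j : Fin p) (Q : Hypergraph (Hypergraph.V P)) where

  private
    module P = Hypergraph P
    module Q = Hypergraph Q

  Vertex⁺ : Set
  Vertex⁺ = Q.V ⊎ (Q.E × P.V)

  place : ∀ {A : Set} ε v → Dec A → Vertex⁺
  place ε v (yes _) = inj₁ (Q.inc ε v)
  place ε v (no  _) = inj₂ (ε , v)

  copy : Q.E → P.V → Vertex⁺
  copy ε v = place ε v (part v ≟ᶠ j)

  part⁺ : Vertex⁺ → Fin p
  part⁺ (inj₁ _)       = j
  part⁺ (inj₂ (_ , v)) = part v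

  part⁺-copy : ∀ ε v → part⁺ (copy ε v) ≡ part v
  part⁺-copy ε v with part v ≟ᶠ j
  ... | yes eq = sym eq
  ... | no  _  = refl

  copy-in : ∀ ε v → part v ≡ j → copy ε v ≡ inj₁ (Q.inc ε v)
  copy-in ε v eq with part v ≟ᶠ j
  ... | yes _ = refl
  ... | no ≢ = contradiction eq ≢

  amalgam : Hypergraph I
  amalgam = record
    { V    = Vertex⁺
    ; E    = Q.E × P.E
    ; finV = finite-⊎ Q.finV (finite-× Q.finE P.finV)
    ; finE = finite-× Q.finE P.finE
    ; inc  = λ (ε , e) i → copy ε (P.inc e i)
    }

  transversal⁺ : Transversal amalgam part⁺
  transversal⁺ (ε , e) {x} {y} eq = transversal e
    (trans (sym (part⁺-copy ε (P.inc e x))) (trans eq (part⁺-copy ε (P.inc e y))))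

  -- Part `j` of the copy `ε` is mapped onto the edge `ε` of `Q`, so a monochromatic edge of `Q`
  -- singles out the copy.
  part-homogeneous : ∀ {t} → VertexRamsey Q t → (c : Vertex⁺ → Fin t) →
    Σ[ ε ∈ Q.E ] ∃[ γ ] (∀ v → part v ≡ j → c (copy ε v) ≡ γ)
  part-homogeneous ramsey c with ramsey (c ∘ inj₁)
  ... | ε , γ , mono = ε , γ , λ v eq → trans (cong c (copy-in ε v eq)) (mono v)

  -- Each copy of `P` is first glued on its own; then its colours are permuted so that all copies
  -- agree on the shared vertices of part `j`.
  gluing⁺ : Finite I → ∀ {h} → Gluing P (suc h) → Gluing Q h → Gluing amalgam (suc h)
  gluing⁺ finI {h} glueP glueQ {k} φ l len = colour , λ (ε , e) e∈ → good ε e e∈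
    where
    open Enumeration Q.finE using () renaming (_≡?_ to _≟E_)
    open Enumeration (finite-× Q.finE P.finE) using () renaming (_≡?_ to _≟EE_)

    -- Only copies containing at least two edges of l constrain the colours of
    -- part j, and they form a shorter list; this drives the induction on h.
    doubled : List Q.E
    doubled = repeats _≟E_ (List.map proj₁ l)

    len₂ : length (List.map proj₂ l) ≤ suc h
    len₂ = ≤-trans (≤-reflexive (length-map proj₂ l)) len

    inner = λ ε → glueP (λ e → φ (ε , e)) (List.map proj₂ l) len₂

    g₀ : Q.E → P.V → Fin (suc k)
    g₀ ε = proj₁ (inner ε)

    outer = glueQ g₀ doubled
      (length-repeats-< _≟E_ (List.map proj₁ l) (≤-trans (≤-reflexive (length-map proj₁ l)) len))

    g₁ : Q.V → Fin (suc k)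
    g₁ = proj₁ outer

    Agree : Q.E → (Fin (suc k) → Fin (suc k)) → Set
    Agree ε τ = ∀ e → (ε , e) ∈ l → ∀ i → part (P.inc e i) ≡ j →
                g₁ (Q.inc ε (P.inc e i)) ≡ τ (g₀ ε (P.inc e i))

    -- A copy occurring only once in l meets part j, within l, in at most one
    -- vertex, so a transposition suffices.
    adjust : ∀ ε → Σ[ τ ∈ (Fin (suc k) → Fin (suc k)) ] (Injective _≡_ _≡_ τ × Agree ε τ)
    adjust ε with Any.any? (ε ≟E_) doubled
    ... | yes ε∈ = let τ , inj , eq = proj₂ outer ε ε∈ in τ , inj , λ e _ i _ → eq (P.inc e i)
    ... | no ε∉ with Enumeration.exists? (finite-× P.finE finI)
                       {λ (e , i) → Σ[ _ ∈ (ε , e) ∈ l ] (part (P.inc e i) ≡ j)} (λ (e , i) →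
                       Any.any? ((ε , e) ≟EE_) l ×-dec part (P.inc e i) ≟ᶠ j)
    ...   | no none = id , id , λ e e∈ i eq → contradiction ((e , i) , e∈ , eq) none
    ...   | yes ((e , i) , e∈ , eq) =
              PC.transpose x y , transpose-injective , agree
      where
      x y : Fin (suc k)
      x = g₀ ε (P.inc e i)
      y = g₁ (Q.inc ε (P.inc e i))

      transpose-injective : Injective _≡_ _≡_ (PC.transpose x y)
      transpose-injective eq =
        trans (sym (PC.transpose-inverse y x)) (trans (cong (PC.transpose y x) eq) (PC.transpose-inverse y x))

      agree : Agree ε (PC.transpose x y)
      agree e′ e′∈ i′ eq′ with repeats-unique _≟E_ proj₁ l e∈ e′∈ refl ε∉
      ... | refl with transversal e (trans eq (sym eq′))
      ...   | refl = sym (transpose-matches x y)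

    colour : Vertex⁺ → Fin (suc k)
    colour (inj₁ y)       = g₁ y
    colour (inj₂ (ε , v)) = proj₁ (adjust ε) (g₀ ε v)

    copied : ∀ ε e → (ε , e) ∈ l → ∀ i →
             colour (copy ε (P.inc e i)) ≡ proj₁ (adjust ε) (g₀ ε (P.inc e i))
    copied ε e e∈ i with part (P.inc e i) ≟ᶠ j
    ... | yes eq = proj₂ (proj₂ (adjust ε)) e e∈ i eq
    ... | no  _  = refl

    good : ∀ ε e → (ε , e) ∈ l → Σ[ σ ∈ (Fin (suc k) → Fin (suc k)) ]
      (Injective _≡_ _≡_ σ × (∀ i → colour (copy ε (P.inc e i)) ≡ σ (φ (ε , e) i)))
    good ε e e∈ =
      let σ , inj , eq = proj₂ (inner ε) e (∈-map⁺ proj₂ e∈)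
          τ , inj′ , _ = adjust ε
      in τ ∘ σ , inj ∘ inj′ , λ i → trans (copied ε e e∈ i) (cong τ (eq i))

SparseRamsey : ℕ → ℕ → Set → Set₁
SparseRamsey h t I = Σ[ H ∈ Hypergraph I ] (Gluing H h × VertexRamsey H t)

-- Kept apart from `SparseRamsey` because the one-vertex hypergraph that starts the induction can
-- have a non-injective edge; `sparseRamsey-step` gains injectivity from transversality.
InjectiveSparseRamsey : ℕ → ℕ → Set → Set₁
InjectiveSparseRamsey h t I = Σ[ H ∈ Hypergraph I ]
  (Gluing H h × VertexRamsey H t × (∀ e → Injective _≡_ _≡_ (Hypergraph.inc H e)))

-- A stage of the partite construction: `w` and `η` map `P₀` into the hypergraph, and `js` lists the
-- parts on which the colour is already constant.
record Homogenisation {I : Set} (P₀ : Hypergraph I) {p : ℕ} (part₀ : Hypergraph.V P₀ → Fin p)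
  (h t : ℕ) (js : List (Fin p)) : Set₁ where
  private
    module P₀ = Hypergraph P₀
  field
    hypergraph  : Hypergraph I
  open Hypergraph hypergraph
  field
    part        : V → Fin p
    transversal : Transversal hypergraph part
    gluing      : Gluing hypergraph h
    homogeneous : (c : V → Fin t) →
      Σ[ w ∈ (P₀.V → V) ] Σ[ η ∈ (P₀.E → E) ]
        ((∀ e i → inc (η e) i ≡ w (P₀.inc e i)) × (∀ v → part (w v) ≡ part₀ v) ×
         (∀ j → j ∈ js → ∃[ γ ] (∀ v → part₀ v ≡ j → c (w v) ≡ γ)))

-- Amalgamating along `j` yields a copy of the previous stage that is constant on part `j`; the
-- previous stage is then applied inside this copy. Since parts are preserved, constancy on `j`
-- survives.
homogenise : ∀ {I h t p} → Finite I → (∀ {J} → Finite J → SparseRamsey h t J) →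
  (P₀ : Hypergraph I) (part₀ : Hypergraph.V P₀ → Fin p) → Transversal P₀ part₀ →
  Gluing P₀ (suc h) → ∀ js → Homogenisation P₀ part₀ (suc h) t js
homogenise finI sparse P₀ part₀ transversal₀ gluing₀ [] = record
  { hypergraph  = P₀
  ; part        = part₀
  ; transversal = transversal₀
  ; gluing      = gluing₀
  ; homogeneous = λ c → id , id , (λ _ _ → refl) , (λ _ → refl) , λ _ ()
  }
homogenise finI sparse P₀ part₀ transversal₀ gluing₀ (j ∷ js)
  with homogenise finI sparse P₀ part₀ transversal₀ gluing₀ js
... | P with sparse (Hypergraph.finV (Homogenisation.hypergraph P))
...   | Q , glueQ , ramseyQ = record
  { hypergraph  = amalgam
  ; part        = part⁺
  ; transversal = transversal⁺
  ; gluing      = gluing⁺ finI gluing glueQ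
  ; homogeneous = homogeneous⁺
  }
  where
  open Homogenisation P
  open Amalgam hypergraph part transversal j Q

  homogeneous⁺ : (c : Vertex⁺ → Fin _) → _
  homogeneous⁺ c with part-homogeneous ramseyQ c
  ... | ε , γ , eq with homogeneous (c ∘ copy ε)
  ...   | w , η , commutes , preserves , mono =
    copy ε ∘ w , (λ e → ε , η e) , (λ e i → cong (copy ε) (commutes e i)) ,
    (λ v → trans (part⁺-copy ε (w v)) (preserves v)) ,
    λ { _ (here refl) → γ , λ v v∈ → eq (w v) (trans (preserves v) v∈)
      ; j′ (there j′∈) → mono j′ j′∈ }

module _ {I : Set} (finI : Finite I) (t : ℕ) where
  open Enumeration finI

  private
    -- More than `t * size` parts force more than `size` of them to share a colour; the further
    -- summand `size` gives `size≤p`, also for `t = 0`.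
    p : ℕ
    p = suc (suc t * size)

    size≤p : size ≤ p
    size≤p = ℕ.m≤n⇒m≤1+n (ℕ.m≤m+n size (t * size))

    injective? : (f : Fin size → Fin p) → Dec (∀ x y → f x ≡ f y → x ≡ y)
    injective? f = all? λ x → all? λ y → (f x ≟ᶠ f y) →-dec (x ≟ᶠ y)

    -- Codes of non-injective functions are sent to a fixed injection.
    positions : Fin (p ^ size) → Fin size → Fin p
    positions e with injective? (finToFun e)
    ... | yes _ = finToFun e
    ... | no  _ = λ x → inject≤ x size≤p

    positions-injective : ∀ e → Injective _≡_ _≡_ (positions e)
    positions-injective e with injective? (finToFun e)
    ... | yes inj = inj _ _
    ... | no  _   = inject≤-injective size≤p size≤p _ _

    positions-surjective : ∀ f → Injective _≡_ _≡_ f → ∃[ e ] (∀ x → positions e x ≡ f x)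
    positions-surjective f inj with injective? (finToFun (funToFin f)) in eq
    ... | no ¬inj = contradiction (λ x y eq → inj (trans (sym (finToFun-funToFin f x))
                      (trans eq (finToFun-funToFin f y)))) ¬inj
    ... | yes _ = funToFin f , λ x → trans (unfold x) (finToFun-funToFin f x)
      where
      unfold : ∀ x → positions (funToFin f) x ≡ finToFun (funToFin f) x
      unfold x rewrite eq = refl

  -- The initial system of the partite construction: disjoint edges, with every injection of the
  -- index set into the parts realised by one of them.
  scattered : Hypergraph I
  scattered = record
    { V    = Fin (p ^ size) × I
    ; E    = Fin (p ^ size)
    ; finV = finite-× (finite-Fin _) finI
    ; finE = finite-Fin _
    ; inc  = _,_
    }

  scattered-part : Fin (p ^ size) × I → Fin p
  scattered-part (e , i) = positions e (index i)

  -- Once every part is homogeneous, the pigeonhole principle yields enough parts of the same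
  -- colour, and the scattered edge across these parts is monochromatic.
  sparseRamsey-step : ∀ {h} → (∀ {J} → Finite J → SparseRamsey h t J) → InjectiveSparseRamsey (suc h) t I
  sparseRamsey-step {h} sparse = hypergraph , gluing , ramsey , λ e eq → transversal e (cong part eq)
    where
    homogenised : Homogenisation scattered scattered-part (suc h) t (List.allFin p)
    homogenised = homogenise finI sparse scattered scattered-part
      (λ e → index-injective ∘ positions-injective e)
      -- Disjoint edges can be glued without permuting any colours.
      (λ φ l _ → (λ (e , i) → φ e i) , λ e _ → id , id , λ _ → refl)
      (List.allFin p)

    open Homogenisation homogenised

    ramsey : VertexRamsey hypergraph t
    ramsey c with homogeneous c
    ... | w , η , commutes , _ , mono
      with pigeonhole t {size} (s≤s (ℕ.m≤n+m (t * size) size)) (λ j → proj₁ (mono j (∈-allFin j)))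
    ... | fibre γ ι ι-inj const with positions-surjective (ι ∘ inject₁) (inject₁-injective ∘ ι-inj)
    ...   | e , eq = η e , γ , λ i → trans (cong c (commutes e i))
              (trans (proj₂ (mono (ι (inject₁ (index i))) (∈-allFin _)) (e , i) (eq (index i)))
                     (const (inject₁ (index i))))

abstract
  -- For `h = 0` the list to be glued is empty, so one vertex with a constant edge suffices. The
  -- step uses the previous case with edges indexed by a whole vertex set, hence the generality in
  -- `I`.
  sparseRamsey : ∀ h t {I} → Finite I → SparseRamsey h t I
  sparseRamsey zero t finI =
    record { V = ⊤ ; E = ⊤ ; finV = finite-⊤ ; finE = finite-⊤ ; inc = λ _ _ → tt } ,
    (λ { φ [] _ → (λ _ → zero) , λ _ () }) ,
    λ c → tt , c tt , λ _ → refl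
  sparseRamsey (suc h) t finI =
    let H , gluing , ramsey , _ = sparseRamsey-step finI t (sparseRamsey h t)
    in H , gluing , ramsey

-- Locally colourable layers

record FiniteGraph : Set₁ where
  infix 4 _~_
  field
    V      : Set
    finV   : Finite V
    point  : V
    _~_    : V → V → Set
    _~?_   : ∀ u v → Dec (u ~ v)
    ~-sym  : ∀ {u v} → u ~ v → v ~ u
    ~-irrefl : ∀ {v} → ¬ v ~ v

record Layering (q : ℕ) (X : FiniteGraph) : Set₁ where
  open FiniteGraph X
  field
    layer     : Fin q → V → V → Set
    layer?    : ∀ i u v → Dec (layer i u v)
    layer-sym : ∀ i {u v} → layer i u v → layer i v u
    covers    : ∀ {u v} → u ~ v → ∃[ i ] layer i u v

open Layering

-- The colours are given to indices rather than vertices: for a map from a graph on `n` vertices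
-- that sends its edges into `R`, `g` is directly a proper colouring of that graph.
LocallyColourable : (n : ℕ) {V : Set} → (V → V → Set) → ℕ → Set
LocallyColourable n {V} R k = (f : Fin n → V) →
  Σ[ g ∈ (Fin n → Fin k) ] (∀ a b → R (f a) (f b) → g a ≢ g b)

-- For `k = ρ` and clique sizes 2 + ρ i, layer `i` is thus locally colourable with one colour fewer
-- than the clique size.
LocalLayering : ∀ n {q} → FiniteGraph → (Fin q → ℕ) → Set₁
LocalLayering n {q} X k =
  Σ[ L ∈ Layering q X ] (∀ i → LocallyColourable n (layer L i) (suc (k i)))

module _ (X : FiniteGraph) where
  open FiniteGraph X

  record Colouring (q : ℕ) : Set where
    field
      colour     : V → V → Fin q
      colour-sym : ∀ u v → colour u v ≡ colour v u

  -- A complete `r`-partite graph with parts of size `m`. Different parts are disjoint by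
  -- irreflexivity of adjacency.
  record Clique {q : ℕ} (c : V → V → Fin q) (i : Fin q) (r m : ℕ) : Set where
    field
      vertex     : Fin r → Fin m → V
      injective  : ∀ a → Injective _≡_ _≡_ (vertex a)
      adjacent   : ∀ {a b} → a ≢ b → ∀ x y → vertex a x ~ vertex b y
      monochrome : ∀ {a b} → a ≢ b → ∀ x y → c (vertex a x) (vertex b y) ≡ i

record Embedding (X Y : FiniteGraph) : Set where
  private
    module X = FiniteGraph X
    module Y = FiniteGraph Y
  field
    map           : X.V → Y.V
    map-injective : Injective _≡_ _≡_ map
    map-edge      : ∀ {u v} → u X.~ v → map u Y.~ map v

module _ {X Y : FiniteGraph} (w : Embedding X Y) where
  open Embedding w

  pull : ∀ {q} → Colouring Y q → Colouring X q
  pull c = record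
    { colour     = λ u v → colour (map u) (map v)
    ; colour-sym = λ u v → colour-sym (map u) (map v)
    }
    where open Colouring c

  push : ∀ {q} {c : FiniteGraph.V Y → FiniteGraph.V Y → Fin q} {i r m} →
         Clique X (λ u v → c (map u) (map v)) i r m → Clique Y c i r m
  push κ = record
    { vertex     = λ a x → map (vertex a x)
    ; injective  = λ a → injective a ∘ map-injective
    ; adjacent   = λ a≢b x y → map-edge (adjacent a≢b x y)
    ; monochrome = monochrome
    }
    where open Clique κ

_∘ᵉ_ : ∀ {X Y Z} → Embedding Y Z → Embedding X Y → Embedding X Z
w ∘ᵉ w′ = record
  { map           = Embedding.map w ∘ Embedding.map w′
  ; map-injective = Embedding.map-injective w′ ∘ Embedding.map-injective w
  ; map-edge      = Embedding.map-edge w ∘ Embedding.map-edge w′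
  }

-- Copies of graphs on the edges of a hypergraph

module Placement {q : ℕ} (X : Fin q → FiniteGraph)
  (H : Hypergraph (Σ[ j ∈ Fin q ] FiniteGraph.V (X j)))
  (inc-injective : ∀ e → Injective _≡_ _≡_ (Hypergraph.inc H e))
  (e₀ : Hypergraph.E H) (j₀ : Fin q) where

  private
    module X j = FiniteGraph (X j)
    module Enumerationˣ j = Enumeration (X.finV j)

  open Hypergraph H
  open Enumeration finV using () renaming (_≡?_ to _≟V_)
  open Enumeration finE using () renaming (exists? to existsE?)

  place : E → ∀ j → X.V j → V
  place e j v = inc e (j , v)

  place-injective : ∀ e j → Injective _≡_ _≡_ (place e j)
  place-injective e j eq =
    ,-injectiveʳ-UIP (Decidable⇒UIP.≡-irrelevant _≟ᶠ_) (inc-injective e eq)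

  Placed : (∀ j → X.V j → X.V j → Set) → V → V → Set
  Placed R y z = Σ[ e ∈ E ] Σ[ j ∈ Fin q ] Σ[ u ∈ X.V j ] Σ[ v ∈ X.V j ]
    (R j u v × place e j u ≡ y × place e j v ≡ z)

  placed? : ∀ {R} → (∀ j u v → Dec (R j u v)) → ∀ y z → Dec (Placed R y z)
  placed? R? y z =
    existsE? λ e → any? λ j → Enumerationˣ.exists? j λ u → Enumerationˣ.exists? j λ v →
    R? j u v ×-dec (place e j u ≟V y ×-dec place e j v ≟V z)

  placed-sym : ∀ {R} → (∀ j {u v} → R j u v → R j v u) → ∀ {y z} → Placed R y z → Placed R z y
  placed-sym R-sym (e , j , u , v , r , eq , eq′) = e , j , v , u , R-sym j r , eq′ , eq

  placed : FiniteGraph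
  placed = record
    { V        = V
    ; finV     = finV
    ; point    = place e₀ j₀ (X.point j₀)
    ; _~_      = Placed X._~_
    ; _~?_     = placed? X._~?_
    ; ~-sym    = placed-sym λ j → X.~-sym j
    ; ~-irrefl = λ (e , j , u , v , u~v , eq , eq′) →
        X.~-irrefl j (subst (X._~_ j u) (sym (place-injective e j (trans eq (sym eq′)))) u~v)
    }

  embed : E → ∀ j → Embedding (X j) placed
  embed e j = record
    { map           = place e j
    ; map-injective = place-injective e j
    ; map-edge      = λ u~v → e , j , _ , _ , u~v , refl , refl
    }

  module _ (n : ℕ) (gluing : Gluing H (n * n)) {R : ∀ j → X.V j → X.V j → Set}
    (R? : ∀ j u v → Dec (R j u v)) {k : ℕ}
    (local : ∀ j → LocallyColourable n (R j) (suc k)) (f : Fin n → V) where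

    private
      -- A left inverse of `place e j`, with an arbitrary value off the copy.
      locate : ∀ e j → V → X.V j
      locate e j y with Enumerationˣ.exists? j (λ v → place e j v ≟V y)
      ... | yes (v , _) = v
      ... | no  _       = X.point j

      locate-place : ∀ e j {v y} → y ≡ place e j v → locate e j y ≡ v
      locate-place e j {v} {y} refl with Enumerationˣ.exists? j (λ v → place e j v ≟V y)
      ... | yes (v′ , eq) = place-injective e j eq
      ... | no  none      = contradiction (v , refl) none

      part = λ e j → local j (locate e j ∘ f)

      -- A vertex of the copy takes the local colour of some index mapped to it, and `zero` if there
      -- is none. As `f` may repeat vertices, `φ-value` records which index was chosen.
      φ : E → (Σ[ j ∈ Fin q ] X.V j) → Fin (suc k)
      φ e (j , v) with any? (λ a → f a ≟V place e j v)
      ... | yes (a , _) = proj₁ (part e j) a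
      ... | no  _       = zero

      φ-value : ∀ e j v a → f a ≡ place e j v →
                ∃[ b ] (f b ≡ place e j v × φ e (j , v) ≡ proj₁ (part e j) b)
      φ-value e j v a eq with any? (λ a → f a ≟V place e j v)
      ... | yes (b , eq′) = b , eq′ , refl
      ... | no  none      = contradiction (a , eq) none

      φ-separates : ∀ e j {u v a b} → R j u v → place e j u ≡ f a → place e j v ≡ f b →
                    φ e (j , u) ≢ φ e (j , v)
      φ-separates e j {u} {v} {a} {b} r eq eq′ same
        with φ-value e j u a (sym eq) | φ-value e j v b (sym eq′)
      ... | a′ , at , value | b′ , at′ , value′ = proj₂ (part e j) a′ b′
        (subst (λ x → R j x _) (sym (locate-place e j at))
          (subst (R j u) (sym (locate-place e j at′)) r))
        (trans (sym value) (trans same value′))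

      edgeOf : ∀ {y z} → Dec (Placed R y z) → E
      edgeOf (yes (e , _)) = e
      edgeOf (no  _)       = e₀

      edgeBetween : Fin n × Fin n → E
      edgeBetween (a , b) = edgeOf (placed? R? (f a) (f b))

      -- One witnessing edge for every ordered pair of indices, which accounts for `n * n` in the
      -- gluing hypothesis.
      edges : List E
      edges = List.tabulate {n = n * n} (edgeBetween ∘ remQuot n)

      glued = gluing φ edges (≤-reflexive (length-tabulate {n = n * n} (edgeBetween ∘ remQuot n)))

      edgeBetween-∈ : ∀ a b → edgeBetween (a , b) ∈ edges
      edgeBetween-∈ a b = subst (λ p → edgeBetween p ∈ edges) (remQuot-combine {n} a b)
        (∈-tabulate⁺ (combine a b))

      separates : ∀ {a b} (d : Dec (Placed R (f a) (f b))) → edgeOf d ∈ edges →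
                  Placed R (f a) (f b) → proj₁ glued (f a) ≢ proj₁ glued (f b)
      separates (no ¬r) _ r = contradiction r ¬r
      separates (yes (e , j , u , v , r , eq , eq′)) e∈ _ same with proj₂ glued e e∈
      ... | σ , σ-inj , on-edge = φ-separates e j r eq eq′ (σ-inj
        (trans (sym (on-edge (j , u))) (trans (cong (proj₁ glued) eq)
          (trans same (trans (cong (proj₁ glued) (sym eq′)) (on-edge (j , v)))))))

    -- On each hypergraph edge the local colourings of all `X j` combine into `φ`. Gluing changes
    -- them only by an injective map of colours on each chosen edge, so adjacent vertices stay
    -- separated.
    placed-colourable : Σ[ g ∈ (Fin n → Fin (suc k)) ] (∀ a b → Placed R (f a) (f b) → g a ≢ g b)
    placed-colourable = proj₁ glued ∘ f , λ a b →
      separates (placed? R? (f a) (f b)) (edgeBetween-∈ a b)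

  placed-layering : (∀ j → Layering q (X j)) → Layering q placed
  placed-layering L = record
    { layer     = λ i → Placed λ j → layer (L j) i
    ; layer?    = λ i → placed? λ j → layer? (L j) i
    ; layer-sym = λ i → placed-sym λ j → layer-sym (L j) i
    ; covers    = λ (e , j , u , v , u~v , eqs) →
        let i , r = covers (L j) u~v in i , e , j , u , v , r , eqs
    }

abstract
  -- Every hypergraph edge carries a copy of each `X j`, so a single monochromatic edge serves all
  -- `j` with the same `γ`.
  vertexRamsey : ∀ n t {q} {k : Fin q → ℕ} (X : Fin q → FiniteGraph) →
    (∀ j → LocalLayering n (X j) k) → Fin t → Fin q →
    Σ[ B ∈ FiniteGraph ] (LocalLayering n B k × ((c : FiniteGraph.V B → Fin t) →
      ∃[ γ ] (∀ j → Σ[ w ∈ Embedding (X j) B ] (∀ v → c (Embedding.map w v) ≡ γ))))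
  vertexRamsey n t {q} X L γ₀ j₀ =
    placed ,
    (placed-layering (proj₁ ∘ L) , λ i →
      placed-colourable n (λ φ l len → gluing φ l (ℕ.m≤n⇒m≤1+n len)) (λ j → layer? (proj₁ (L j)) i) (λ j → proj₂ (L j) i)) ,
    λ c → let e , γ , mono = ramsey c in γ , λ j → embed e j , λ v → mono (j , v)
    where
    -- The last step is taken explicitly, as it is the one that makes edges injective; hence the
    -- successor.
    hypergraph : InjectiveSparseRamsey (suc (n * n)) t (Σ[ j ∈ Fin q ] FiniteGraph.V (X j))
    hypergraph = sparseRamsey-step (finite-Σ q (λ j → FiniteGraph.finV (X j))) t (sparseRamsey (n * n) t)
    gluing : Gluing (proj₁ hypergraph) (suc (n * n))
    gluing = proj₁ (proj₂ hypergraph)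
    ramsey : VertexRamsey (proj₁ hypergraph) t
    ramsey = proj₁ (proj₂ (proj₂ hypergraph))
    -- A constant colouring provides an edge, and with it a vertex for `point`.
    open Placement X (proj₁ hypergraph) (proj₂ (proj₂ (proj₂ hypergraph))) (proj₁ (ramsey λ _ → γ₀)) j₀

-- The complete join of B with u independent vertices; π chooses the layers of
-- the new edges.
module Join (B : FiniteGraph) (u : ℕ) where
  open FiniteGraph B

  Joined : (V → V → Set) → (Fin u → Set) → V ⊎ Fin u → V ⊎ Fin u → Set
  Joined R S (inj₁ y) (inj₁ z) = R y z
  Joined R S (inj₁ _) (inj₂ x) = S x
  Joined R S (inj₂ x) (inj₁ _) = S x
  Joined R S (inj₂ _) (inj₂ _) = ⊥

  joined? : ∀ {R S} → (∀ y z → Dec (R y z)) → (∀ x → Dec (S x)) → ∀ y z → Dec (Joined R S y z)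
  joined? R? S? (inj₁ y) (inj₁ z) = R? y z
  joined? R? S? (inj₁ _) (inj₂ x) = S? x
  joined? R? S? (inj₂ x) (inj₁ _) = S? x
  joined? R? S? (inj₂ _) (inj₂ _) = no λ ()

  joined-sym : ∀ {R S} → (∀ {y z} → R y z → R z y) → ∀ y z → Joined R S y z → Joined R S z y
  joined-sym R-sym (inj₁ y) (inj₁ z) r = R-sym r
  joined-sym R-sym (inj₁ _) (inj₂ x) s = s
  joined-sym R-sym (inj₂ x) (inj₁ _) s = s

  joined-irrefl : ∀ y → ¬ Joined _~_ (λ _ → ⊤) y y
  joined-irrefl (inj₁ y) = ~-irrefl

  join : FiniteGraph
  join = record
    { V        = V ⊎ Fin u
    ; finV     = finite-⊎ finV (finite-Fin u)
    ; point    = inj₁ point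
    ; _~_      = Joined _~_ (λ _ → ⊤)
    ; _~?_     = joined? _~?_ (λ _ → yes tt)
    ; ~-sym    = λ {y} {z} → joined-sym ~-sym y z
    ; ~-irrefl = λ {y} → joined-irrefl y
    }

  base : Embedding B join
  base = record { map = inj₁ ; map-injective = inj₁-injective ; map-edge = id }

  module _ {q : ℕ} (L : Layering q B) (π : Fin u → Fin q) where
    join-layering : Layering q join
    join-layering = record
      { layer     = λ i → Joined (layer L i) (λ x → π x ≡ i)
      ; layer?    = λ i → joined? (layer? L i) (λ x → π x ≟ᶠ i)
      ; layer-sym = λ i {y} {z} → joined-sym (layer-sym L i) y z
      ; covers    = λ {y} {z} → join-covers y z
      }
      where
      join-covers : ∀ y z → Joined _~_ (λ _ → ⊤) y z → ∃[ i ] Joined (layer L i) (λ x → π x ≡ i) y z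
      join-covers (inj₁ y) (inj₁ z) r = covers L r
      join-covers (inj₁ _) (inj₂ x) _ = π x , refl
      join-covers (inj₂ x) (inj₁ _) _ = π x , refl

    -- Colour `zero` is reserved for the joined vertices whose edges lie in layer `i`. The other
    -- joined vertices are isolated in that layer and can reuse `suc zero`.
    join-colourable : ∀ {n k} i → LocallyColourable n (layer L i) (suc k) → (f : Fin n → V ⊎ Fin u) →
      Σ[ g ∈ (Fin n → Fin (suc (suc k))) ]
        ((∀ a b → layer join-layering i (f a) (f b) → g a ≢ g b) ×
         (∀ a → g a ≡ zero → Σ[ x ∈ Fin u ] (f a ≡ inj₂ x × π x ≡ i)))
    join-colourable {n} {k} i local f =
      (λ a → colour a (f a)) , (λ a b → separate a b (f a) (f b) refl refl) , λ a → zeros a (f a)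
      where
      below : V ⊎ Fin u → V
      below (inj₁ y) = y
      below (inj₂ _) = point

      part = local (below ∘ f)

      colour : Fin n → V ⊎ Fin u → Fin (suc (suc k))
      colour a (inj₁ _) = suc (proj₁ part a)
      colour a (inj₂ x) with π x ≟ᶠ i
      ... | yes _ = zero
      ... | no  _ = suc zero

      colour-top : ∀ a x → π x ≡ i → colour a (inj₂ x) ≡ zero
      colour-top a x eq with π x ≟ᶠ i
      ... | yes _ = refl
      ... | no  ≢ = contradiction eq ≢

      separate : ∀ a b y z → f a ≡ y → f b ≡ z → layer join-layering i y z → colour a y ≢ colour b z
      separate a b (inj₁ y) (inj₁ z) eq eq′ r same = proj₂ part a b
        (subst (λ y′ → layer L i (below y′) (below (f b))) (sym eq)
          (subst (λ z′ → layer L i y (below z′)) (sym eq′) r))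
        (suc-injective same)
      separate a b (inj₁ y) (inj₂ x) _ _ s same with trans same (colour-top b x s)
      ... | ()
      separate a b (inj₂ x) (inj₁ y) _ _ s same with trans (sym same) (colour-top a x s)
      ... | ()

      zeros : ∀ a y → colour a y ≡ zero → Σ[ x ∈ Fin u ] (y ≡ inj₂ x × π x ≡ i)
      zeros a (inj₂ x) eq with π x ≟ᶠ i
      ... | yes πx = x , refl , πx

-- Arrowing by induction on the clique sizes

module _ {q : ℕ} (ρ : Fin q → ℕ) (m : ℕ) where
  Arrows : FiniteGraph → Set
  Arrows X = (c : Colouring X q) → ∃[ i ] Clique X (Colouring.colour c) i (suc (suc (ρ i))) m

  -- In colour `j` one part fewer is enough, because the joined vertices will supply the missing
  -- part.
  ArrowsBelow : Fin q → FiniteGraph → Set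
  ArrowsBelow j X = (c : Colouring X q) →
    (∃[ i ] Clique X (Colouring.colour c) i (suc (suc (ρ i))) m) ⊎
    Clique X (Colouring.colour c) j (suc (ρ j)) m

  record Star (B : FiniteGraph) (u s : ℕ)
    (c : FiniteGraph.V B ⊎ Fin u → FiniteGraph.V B ⊎ Fin u → Fin q) : Set where
    field
      hue           : Fin q
      centre        : Fin s → Fin u
      centre-inj    : Injective _≡_ _≡_ centre
      clique        : Clique B (λ y z → c (inj₁ y) (inj₁ z)) hue (suc (ρ hue)) m
      centre-colour : ∀ a x y → c (inj₁ (Clique.vertex clique a x)) (inj₂ (centre y)) ≡ hue

  star⇒clique : ∀ {B u} (c : Colouring (Join.join B u) q) (S : Star B u (suc m) (Colouring.colour c)) →
    Clique (Join.join B u) (Colouring.colour c) (Star.hue S) (suc (suc (ρ (Star.hue S)))) m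
  star⇒clique {B} {u} c S = record
    { vertex     = vertex⁺
    ; injective  = λ { zero → inject₁-injective ∘ centre-inj ∘ inj₂-injective
                     ; (suc a) → injective a ∘ inj₁-injective }
    ; adjacent   = λ {a} {b} → adjacent⁺ a b
    ; monochrome = λ {a} {b} → monochrome⁺ a b
    }
    where
    open Star S
    open Clique clique
    open Colouring c
    open Join B u

    vertex⁺ : Fin (suc (suc (ρ hue))) → Fin m → FiniteGraph.V B ⊎ Fin u
    vertex⁺ zero    x = inj₂ (centre (inject₁ x))
    vertex⁺ (suc a) x = inj₁ (vertex a x)

    adjacent⁺ : ∀ a b → a ≢ b → ∀ x y → FiniteGraph._~_ join (vertex⁺ a x) (vertex⁺ b y)
    adjacent⁺ zero    zero    ≢ _ _ = contradiction refl ≢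
    adjacent⁺ zero    (suc b) _ _ _ = tt
    adjacent⁺ (suc a) zero    _ _ _ = tt
    adjacent⁺ (suc a) (suc b) ≢ x y = adjacent (≢ ∘ cong suc) x y

    monochrome⁺ : ∀ a b → a ≢ b → ∀ x y → colour (vertex⁺ a x) (vertex⁺ b y) ≡ hue
    monochrome⁺ zero    zero    ≢ _ _ = contradiction refl ≢
    monochrome⁺ zero    (suc b) _ x y = trans (colour-sym _ _) (centre-colour b y (inject₁ x))
    monochrome⁺ (suc a) zero    _ x y = centre-colour a x (inject₁ y)
    monochrome⁺ (suc a) (suc b) ≢ x y = monochrome (≢ ∘ cong suc) x y

  -- The layering is recorded for the base only, so that the layers of the new edges remain to be
  -- chosen: all equal to some `j` in the induction, `balanced` at the end.
  record JoinArrow (n u s : ℕ) : Set₁ where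
    field
      base     : FiniteGraph
      layering : Layering q base
      local    : ∀ i → LocallyColourable n (layer layering i) (suc (ρ i))
      arrow    : (c : Colouring (Join.join base u) q) →
        (∃[ i ] Clique (Join.join base u) (Colouring.colour c) i (suc (suc (ρ i))) m) ⊎
        Star base u s (Colouring.colour c)

  arrow-join : ∀ n (X : Fin q → FiniteGraph) → (∀ j → ArrowsBelow j (X j)) →
    (∀ j → LocalLayering n (X j) ρ) → Fin q → ∀ u s → q * s < u →
    JoinArrow n u (suc s)
  arrow-join n X arrows L j₀ u s q*s<u
    -- `Fin (q ^ u)` encodes the vectors of colours towards the joined vertices; the vector with all
    -- entries `j₀` shows that it is inhabited.
    with vertexRamsey n (q ^ u) X L (funToFin {u} λ _ → j₀) j₀
  ... | B , (LB , localB) , ramsey = record { base = B ; layering = LB ; local = localB ; arrow = found }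
    where
    open Join B u

    found : (c : Colouring join q) →
      (∃[ i ] Clique join (Colouring.colour c) i (suc (suc (ρ i))) m) ⊎ Star B u (suc s) (Colouring.colour c)
    found c with ramsey (λ y → funToFin λ x → Colouring.colour c (inj₁ y) (inj₂ x))
    -- The most popular entry `i` of the common vector `γ` decides which of the graphs `X i` is
    -- used.
    ... | γ , copies with pigeonhole q q*s<u (finToFun γ)
    ...   | fibre i ι ι-inj const with copies i
    ...     | w , agrees with arrows i (pull (base ∘ᵉ w) c)
    ...       | inj₁ (i′ , κ) = inj₁ (i′ , push (base ∘ᵉ w) κ)
    ...       | inj₂ κ = inj₂ record
      { hue           = i
      ; centre        = ι
      ; centre-inj    = ι-inj
      ; clique        = push w κ
      ; centre-colour = λ a x y → trans
          (sym (finToFun-funToFin _ (ι y)))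
          (trans (cong (λ γ′ → finToFun γ′ (ι y)) (agrees (Clique.vertex κ a x))) (const y))
      }

total : ∀ {q} → (Fin q → ℕ) → ℕ
total {zero}  ρ = 0
total {suc q} ρ = ρ zero + total (ρ ∘ suc)

total-pred : ∀ {q} (ρ : Fin q → ℕ) j {m} → ρ j ≡ suc m → total (updateAt ρ j pred) < total ρ
total-pred ρ zero eq rewrite eq = ≤-refl
total-pred ρ (suc j) eq = ℕ.+-monoʳ-< (ρ zero) (total-pred (ρ ∘ suc) j eq)

locallyColourable-mono : ∀ {n V k k′} {R : V → V → Set} → k ≤ k′ →
  LocallyColourable n R k → LocallyColourable n R k′
locallyColourable-mono k≤k′ local f =
  let g , proper = local f
  in (λ a → inject≤ (g a) k≤k′) , λ a b r → proper a b r ∘ inject≤-injective k≤k′ k≤k′ _ _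

-- The order `suc m` makes `point` available even when `m` is zero.
independent : ℕ → FiniteGraph
independent m = record
  { V = Fin (suc m) ; finV = finite-Fin _ ; point = zero ; _~_ = λ _ _ → ⊥ ; _~?_ = λ _ _ → no λ ()
  ; ~-sym = λ () ; ~-irrefl = λ () }

independent-layering : ∀ n {q} m (k : Fin q → ℕ) → LocalLayering n (independent m) k
independent-layering n m k =
  record { layer = λ _ _ _ → ⊥ ; layer? = λ _ _ _ → no λ () ; layer-sym = λ _ () ; covers = λ () } ,
  λ i f → (λ _ → zero) , λ _ _ ()

independent-clique : ∀ {q} m (c : Fin (suc m) → Fin (suc m) → Fin q) i → Clique (independent m) c i 1 m
independent-clique m c i = record
  { vertex     = λ _ → inject₁
  ; injective  = λ _ → inject₁-injective
  ; adjacent   = λ { {zero} {zero} 0≢0 → contradiction refl 0≢0 }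
  ; monochrome = λ { {zero} {zero} 0≢0 → contradiction refl 0≢0 }
  }

-- The clique sizes r_i of the header are 2 + ρ i.
SparseArrow : ∀ (n m : ℕ) {q} → (Fin q → ℕ) → Set₁
SparseArrow n m ρ = Σ[ X ∈ FiniteGraph ] (Arrows ρ m X × ∀ j → LocalLayering n X (updateAt ρ j suc))

SparseArrowBelow : ∀ (n m : ℕ) {q} → (Fin q → ℕ) → Fin q → Set₁
SparseArrowBelow n m ρ j = Σ[ X ∈ FiniteGraph ] (ArrowsBelow ρ m j X × LocalLayering n X ρ)

module _ (n m : ℕ) {q : ℕ} where
  -- For `ρ j ≡ 0` the reduced clique in colour `j` has a single part and hence no edges.
  below-zero : (ρ : Fin q → ℕ) (j : Fin q) → ρ j ≡ 0 → SparseArrowBelow n m ρ j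
  below-zero ρ j eq =
    independent m ,
    (λ c → inj₂ (subst (λ r → Clique (independent m) (Colouring.colour c) j (suc r) m) (sym eq)
                  (independent-clique m (Colouring.colour c) j))) ,
    independent-layering n m ρ

  -- The free choice of the exceptional layer matters here: it is taken to be `j`, where the size
  -- was decreased, so the increase cancels the decrease and every layer has exactly the bound given
  -- by `ρ`.
  below-suc : (ρ : Fin q → ℕ) (j : Fin q) {k : ℕ} → ρ j ≡ suc k →
    SparseArrow n m (updateAt ρ j pred) → SparseArrowBelow n m ρ j
  below-suc ρ j {k} eq (X , arrows , layerings) = X , arrowsBelow , L , λ i →
      subst (λ k → LocallyColourable n (layer L i) (suc k)) (restore i) (local i)
    where
    L     = proj₁ (layerings j)
    local = proj₂ (layerings j)

    restore : ∀ i → updateAt (updateAt ρ j pred) j suc i ≡ ρ i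
    restore i with i ≟ᶠ j
    ... | yes refl = trans (updateAt-updates i (updateAt ρ i pred))
                       (trans (cong suc (trans (updateAt-updates i ρ) (cong pred eq))) (sym eq))
    ... | no  i≢j  = trans (updateAt-minimal i j (updateAt ρ j pred) i≢j) (updateAt-minimal i j ρ i≢j)

    arrowsBelow : ArrowsBelow ρ m j X
    arrowsBelow c with arrows c
    ... | i , κ with i ≟ᶠ j
    ...   | yes refl = inj₂ (subst (λ r → Clique X (Colouring.colour c) i r m)
              (cong suc (trans (cong suc (trans (updateAt-updates i ρ) (cong pred eq))) (sym eq))) κ)
    ...   | no  i≢j  = inj₁ (i , subst (λ r → Clique X (Colouring.colour c) i (suc (suc r)) m)
              (updateAt-minimal i j ρ i≢j) κ)

  -- With all new edges in layer `j`, only this layer needs the additional colour; in the others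
  -- `zero` never occurs and is removed by `punchOut`.
  joinArrow⇒sparseArrow : (ρ : Fin q → ℕ) → JoinArrow ρ m n (suc (q * m)) (suc m) → SparseArrow n m ρ
  joinArrow⇒sparseArrow ρ J = join , arrows , layered
    where
    open JoinArrow J using (layering; local; arrow)
    open Join (JoinArrow.base J) (suc (q * m))

    arrows : Arrows ρ m join
    arrows c with arrow c
    ... | inj₁ κ = κ
    ... | inj₂ S = Star.hue S , star⇒clique ρ m c S

    layered : ∀ j → LocalLayering n join (updateAt ρ j suc)
    layered j = join-layering layering (λ _ → j) , colourable
      where
      colourable : ∀ i → LocallyColourable n (layer (join-layering layering λ _ → j) i) (suc (updateAt ρ j suc i))
      colourable i f with i ≟ᶠ j | join-colourable layering (λ _ → j) i (local i) f
      ... | yes refl | g , proper , _ rewrite updateAt-updates i {suc} ρ = g , proper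
      ... | no i≢j | g , proper , zeros rewrite updateAt-minimal i j {suc} ρ i≢j =
        (λ a → punchOut (nonzero a)) ,
        λ a b r eq → proper a b r (punchOut-injective (nonzero a) (nonzero b) eq)
        where
        nonzero : ∀ a → zero ≢ g a
        nonzero a eq = i≢j (sym (proj₂ (proj₂ (zeros a (sym eq)))))

  joinArrow : (ρ : Fin q → ℕ) → Fin q → ∀ u s → q * s < u → (∀ j → SparseArrowBelow n m ρ j) →
              JoinArrow ρ m n u (suc s)
  joinArrow ρ j₀ u s q*s<u below =
    arrow-join ρ m n (proj₁ ∘ below) (proj₁ ∘ proj₂ ∘ below) (proj₂ ∘ proj₂ ∘ below) j₀ u s q*s<u

  sparseArrow-from-below : (ρ : Fin q → ℕ) → Fin q → (∀ j → SparseArrowBelow n m ρ j) → SparseArrow n m ρ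
  sparseArrow-from-below ρ j₀ below = joinArrow⇒sparseArrow ρ (joinArrow ρ j₀ (suc (q * m)) m ≤-refl below)

abstract
  -- The bound `b` makes the induction on the total structural: decreasing `ρ j` lowers the total,
  -- after which all colours are treated for the new sizes.
  sparseArrowBelow : ∀ n m {q} b (ρ : Fin q → ℕ) → Fin q → total ρ ≤ b →
    ∀ j r → ρ j ≡ r → SparseArrowBelow n m ρ j
  sparseArrowBelow n m b       ρ j₀ ≤b j zero    eq = below-zero n m ρ j eq
  sparseArrowBelow n m zero    ρ j₀ ≤b j (suc _) eq with () ← ℕ.<-≤-trans (total-pred ρ j eq) ≤b
  sparseArrowBelow n m (suc b) ρ j₀ ≤b j (suc _) eq = below-suc n m ρ j eq
    (sparseArrow-from-below n m _ j₀ λ j′ →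
      sparseArrowBelow n m b _ j₀ (ℕ.≤-pred (ℕ.<-≤-trans (total-pred ρ j eq) ≤b)) j′ _ refl)

  sparseArrow : ∀ n m {q} (ρ : Fin q → ℕ) → Fin q → SparseArrow n m ρ
  sparseArrow n m ρ j₀ =
    sparseArrow-from-below n m ρ j₀ λ j → sparseArrowBelow n m (total ρ) ρ j₀ ≤-refl j _ refl

-- Transfer to Graph

module _ (X : FiniteGraph) where
  open FiniteGraph X
  open Enumeration finV using (size; index; element; element-index; index-injective; element-injective)

  toGraph : Graph
  toGraph = record
    { order    = size
    ; nonEmpty = nonZeroIndex (index point)
    ; _~_      = λ u v → element u ~ element v
    ; _~?_     = λ u v → element u ~? element v
    ; ~-sym    = ~-sym
    ; ~-irrefl = λ { refl → ~-irrefl }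
    }

  record MonochromaticCopy (G : Graph) {q : ℕ} (c : V → V → Fin q) (i : Fin q) : Set where
    private
      module G = Graph G
    field
      vertex     : Vertex G → V
      injective  : Injective _≡_ _≡_ vertex
      adjacent   : ∀ {u v} → u G.~ v → vertex u ~ vertex v
      monochrome : ∀ {u v} → u G.~ v → c (vertex u) (vertex v) ≡ i

  toGraph-arrows : ∀ {q G} →
    ((c : Colouring X (suc q)) → ∃[ i ] MonochromaticCopy G (Colouring.colour c) i) →
    toGraph ⟶⟨ suc q ⟩ G
  toGraph-arrows {q} {G} arrows c = κ , i , mono
    where
    module G = Graph G
    module F = Graph toGraph
    open EdgeColouring c

    -- A `Colouring` also colours non-adjacent pairs; these get the colour `zero`.
    on : ∀ u v → Dec (u F.~ v) → Fin (suc q)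
    on u v (yes e) = colour {u} {v} e
    on u v (no  _) = zero

    on-sym : ∀ u v (d : Dec (u F.~ v)) (d′ : Dec (v F.~ u)) → on u v d ≡ on v u d′
    on-sym u v (yes e) (yes e′) = unoriented {u} {v} e e′
    on-sym u v (yes e) (no ¬e)  = contradiction (~-sym e) ¬e
    on-sym u v (no ¬e) (yes e)  = contradiction (~-sym e) ¬e
    on-sym u v (no _)  (no _)   = refl

    on-edge : ∀ u v (d : Dec (u F.~ v)) e → colour {u} {v} e ≡ on u v d
    -- Going through the reversed edge, two uses of `unoriented` show that the colour does not
    -- depend on the adjacency proof.
    on-edge u v (yes e′) e = trans (unoriented {u} {v} e (~-sym e)) (unoriented {v} {u} (~-sym e) e′)
    on-edge u v (no ¬e)  e = contradiction e ¬e

    on-X : V → V → Fin (suc q)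
    on-X u v = on (index u) (index v) (index u F.~? index v)

    found : ∃[ i ] MonochromaticCopy G on-X i
    found = arrows record
      { colour     = on-X
      ; colour-sym = λ u v → on-sym (index u) (index v) (index u F.~? index v) (index v F.~? index u)
      }

    i = proj₁ found
    open MonochromaticCopy (proj₂ found)

    κ : Copy G toGraph
    κ = record
      { vertex    = index ∘ vertex
      ; injective = injective ∘ index-injective
      ; edge      = λ e → subst₂ _~_ (sym (element-index _)) (sym (element-index _)) (adjacent e)
      }

    mono : ∀ {u v} (e : u G.~ v) → colour (Copy.edge κ e) ≡ i
    mono {u} {v} e = trans
      (on-edge (index (vertex u)) (index (vertex v)) (index (vertex u) F.~? index (vertex v)) (Copy.edge κ e))
      (monochrome e)

  module _ {q : ℕ} (L : Layering q X) where
    private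
      module F = Graph toGraph

      choice : ∀ {u v} → u ~ v → Dec (∃[ i ] layer L i u v) → Fin q
      choice e (yes (i , _)) = i
      choice e (no none)     = contradiction (covers L e) none

      choice-layer : ∀ {u v} (e : u ~ v) d → layer L (choice e d) u v
      choice-layer e (yes (_ , r)) = r
      choice-layer e (no none)     = contradiction (covers L e) none

      choice-irrelevant : ∀ {u v} (e e′ : u ~ v) d → choice e d ≡ choice e′ d
      choice-irrelevant e e′ (yes _)   = refl
      choice-irrelevant e e′ (no none) = contradiction (covers L e) none

      anyLayer? : ∀ u v → Dec (∃[ i ] layer L i u v)
      anyLayer? u v = any? λ i → layer? L i u v

      -- An edge may lie in several layers; orienting it by the order of its
      -- ends makes the chosen layer independent of its direction.
      oriented : ∀ u v → u F.~ v → Dec (u ≤ᶠ v) → Fin q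
      oriented u v e (yes _) = choice e (anyLayer? (element u) (element v))
      oriented u v e (no  _) = choice (~-sym e) (anyLayer? (element v) (element u))

      oriented-sym : ∀ u v (e : u F.~ v) (e′ : v F.~ u) d d′ → oriented u v e d ≡ oriented v u e′ d′
      oriented-sym u v e e′ (yes u≤v) (yes v≤u) with Fin.≤-antisym u≤v v≤u
      ... | refl = choice-irrelevant e e′ (anyLayer? (element u) (element u))
      oriented-sym u v e e′ (yes _) (no _) = choice-irrelevant e (~-sym e′) (anyLayer? (element u) (element v))
      oriented-sym u v e e′ (no _) (yes _) = choice-irrelevant (~-sym e) e′ (anyLayer? (element v) (element u))
      oriented-sym u v e e′ (no u≰v) (no v≰u) with Fin.≤-total u v
      ... | inj₁ u≤v = contradiction u≤v u≰v
      ... | inj₂ v≤u = contradiction v≤u v≰u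

      oriented-layer : ∀ u v (e : u F.~ v) d → layer L (oriented u v e d) (element u) (element v)
      oriented-layer u v e (yes _) = choice-layer e (anyLayer? (element u) (element v))
      oriented-layer u v e (no  _) = layer-sym L _ (choice-layer (~-sym e) (anyLayer? (element v) (element u)))

      layer-colouring : EdgeColouring toGraph q
      layer-colouring = record
        { colour     = λ {u} {v} e → oriented u v e (u ≤?ᶠ v)
        ; unoriented = λ {u} {v} e e′ → oriented-sym u v e e′ (u ≤?ᶠ v) (v ≤?ᶠ u)
        }

    layer-copy : ∀ {H} → toGraph ⟶⟨ q ⟩ H →
      ∃[ i ] Σ[ w ∈ (Vertex H → V) ]
        (Injective _≡_ _≡_ w × ∀ u v → Graph._~_ H u v → layer L i (w u) (w v))
    layer-copy {H} arrows with arrows layer-colouring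
    ... | κ , i , mono = i , element ∘ vertex , injective ∘ element-injective , λ u v e →
        subst (λ i → layer L i _ _) (mono e) (oriented-layer (vertex u) (vertex v) (edge e) (vertex u ≤?ᶠ vertex v))
      where open Copy κ

  -- Vertex `v` goes to position `v` of the part given by its colour, which is why parts of size
  -- `order G` suffice.
  clique-copy : ∀ (G : Graph) {q} {c : V → V → Fin q} {i r} → Clique X c i r (order G) →
    Colourable G r → MonochromaticCopy G c i
  clique-copy G κ (f , proper) = record
    { vertex     = λ v → vertex (f v) v
    ; injective  = λ {u} {v} → separated u v
    ; adjacent   = λ {u} {v} e → adjacent (proper u v e) u v
    ; monochrome = λ {u} {v} e → monochrome (proper u v e) u v
    }
    where
    open Clique κ
    separated : ∀ u v → vertex (f u) u ≡ vertex (f v) v → u ≡ v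
    separated u v eq with f u ≟ᶠ f v
    ... | yes same = injective (f v) (trans (cong (λ a → vertex a u) (sym same)) eq)
    ... | no a≢b = contradiction (subst (vertex (f u) u ~_) (sym eq) (adjacent a≢b u v)) ~-irrefl

-- The class of colour `zero` is ranked into the centres, and the other classes go to the parts of
-- the clique as in `clique-copy`.
star-copy : ∀ (G : Graph) {q B u s k} (c : Colouring (Join.join B u) (suc q)) →
  (S : Star (λ _ → k) (order G) B u s (Colouring.colour c)) →
  (f : Vertex G → Fin (suc (suc k))) → Proper G f → #colour₁ G f ≤ s →
  MonochromaticCopy (Join.join B u) G (Colouring.colour c) (Star.hue S)
star-copy G {B = B} {u} {s} {k} c S f proper few = record
  { vertex     = λ v → vertex⁺ v (f v) refl
  ; injective  = λ {x} {y} → injective⁺ x y (f x) (f y) refl refl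
  ; adjacent   = λ {x} {y} e → proj₁ (edge⁺ x y (f x) (f y) refl refl (proper x y e))
  ; monochrome = λ {x} {y} e → proj₂ (edge⁺ x y (f x) (f y) refl refl (proper x y e))
  }
  where
  open Star S
  open Clique clique
  open Colouring c
  open Join B u
  open FiniteGraph B using (_~_; ~-irrefl)

  ranking = rank (λ v → toℕ (f v) ≟ 0) {order G} id

  apex : ∀ v → f v ≡ zero → Fin u
  apex v eq = centre (inject≤ (proj₁ ranking v (cong toℕ eq)) few)

  vertex⁺ : ∀ v a → f v ≡ a → FiniteGraph.V join
  vertex⁺ v zero    eq = inj₂ (apex v eq)
  vertex⁺ v (suc a) eq = inj₁ (vertex a v)

  injective⁺ : ∀ x y a b eq eq′ → vertex⁺ x a eq ≡ vertex⁺ y b eq′ → x ≡ y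
  injective⁺ x y zero zero eq eq′ same =
    proj₂ ranking _ _ (inject≤-injective few few _ _ (centre-inj (inj₂-injective same)))
  injective⁺ x y (suc a) (suc b) eq eq′ same with a ≟ᶠ b
  ... | yes refl = injective a (inj₁-injective same)
  ... | no a≢b = contradiction (subst (vertex a x ~_) (sym (inj₁-injective same)) (adjacent a≢b x y)) ~-irrefl

  edge⁺ : ∀ x y a b eq eq′ → a ≢ b →
    FiniteGraph._~_ join (vertex⁺ x a eq) (vertex⁺ y b eq′) × colour (vertex⁺ x a eq) (vertex⁺ y b eq′) ≡ hue
  edge⁺ x y zero    zero    eq eq′ a≢b = contradiction refl a≢b
  edge⁺ x y zero    (suc b) eq eq′ _ = _ , trans (colour-sym _ _) (centre-colour b y _)
  edge⁺ x y (suc a) zero    eq eq′ _ = _ , centre-colour a x _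
  edge⁺ x y (suc a) (suc b) eq eq′ a≢b = adjacent (a≢b ∘ cong suc) x y , monochrome (a≢b ∘ cong suc) x y

-- Distinguishing graphs

SparseChromaticArrow : (n m q k : ℕ) → Set₁
SparseChromaticArrow n m q k = Σ[ X ∈ FiniteGraph ]
  (((c : Colouring X (suc q)) → ∃[ i ] Clique X (Colouring.colour c) i k m) ×
   Σ[ L ∈ Layering (suc q) X ] (∀ i → LocallyColourable n (layer L i) k))

abstract
  -- A single part needs no edges. From two parts on, layer `zero` is taken as the exceptional one,
  -- and the smaller bounds of the other layers are relaxed to its bound.
  sparseChromaticArrow : ∀ n m q k → SparseChromaticArrow n m q (suc k)
  sparseChromaticArrow n m q zero =
    independent m , (λ c → zero , independent-clique m (Colouring.colour c) zero) ,
    independent-layering n m (λ _ → 0)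
  sparseChromaticArrow n m q (suc k) =
    let X , arrows , layerings = sparseArrow n m {suc q} (λ _ → k) zero
        L , local = layerings zero
    in X , arrows , L , λ i → locallyColourable-mono {R = layer L i} (bound i) (local i)
    where
    bound : ∀ i → suc (updateAt {n = suc q} (λ _ → k) zero suc i) ≤ suc (suc k)
    bound zero    = ≤-refl
    bound (suc i) = s≤s (ℕ.n≤1+n k)

module _ (G : Graph) where
  someVertex : Vertex G
  someVertex with order G | Graph.nonEmpty G
  ... | suc _ | _ = zero

  χ-least : ∀ {k} → Colourable G k → χ G ≤ k
  χ-least = proj₂ (proj₂ (chromatic G)) _

  χ-colouring : Colourable G (χ G)
  χ-colouring = proj₁ (proj₂ (chromatic G))

  a-least : ∀ {k} → χ G ≡ k → (f : Vertex G → Fin k) → Proper G f → a G ≤ #colour₁ G f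
  a-least refl f proper = proj₂ (proj₂ (smallestClass G)) _ (f , proper , refl)

  a-colouring : ∀ {k} → χ G ≡ k → Σ[ f ∈ (Vertex G → Fin k) ] (Proper G f × #colour₁ G f ≡ a G)
  a-colouring refl = proj₁ (proj₂ (smallestClass G))

  χ≢0 : χ G ≢ 0
  χ≢0 eq with () ← subst Fin eq (proj₁ χ-colouring someVertex)

  #colour₁≡0⇒colourable : ∀ {k} (f : Vertex G → Fin (suc k)) → Proper G f → #colour₁ G f ≡ 0 →
                          Colourable G k
  #colour₁≡0⇒colourable f proper none =
    (λ v → punchOut (nonzero v)) ,
    λ u v e eq → proper u v e (punchOut-injective (nonzero u) (nonzero v) eq)
    where
    nonzero : ∀ v → zero ≢ f v
    nonzero v eq with () ← subst Fin none
      (proj₁ (rank (λ v → toℕ (f v) ≟ 0) {order G} id) v (cong toℕ (sym eq)))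

  -- An empty class of colour 1 could be removed, leaving a proper colouring in fewer than `χ G`
  -- colours.
  a≢0 : ∀ {k} → χ G ≡ suc k → a G ≢ 0
  a≢0 {k} χ≡ a≡0 =
    let f , proper , size = a-colouring χ≡
    in ℕ.1+n≰n (subst (_≤ k) χ≡ (χ-least (#colour₁≡0⇒colourable f proper (trans size a≡0))))

Distinguishes : ℕ → Graph → Graph → Graph → Set
Distinguishes q G H F = F ⟶⟨ q ⟩ G × ¬ (F ⟶⟨ q ⟩ H)

-- A monochromatic copy of `H` would place its `order H` vertices in one layer, whose local
-- colouring would make `H` colourable in `χ G` colours.
distinguish-χ : ∀ G H q → χ G < χ H → ∃ (Distinguishes (suc q) G H)
distinguish-χ G H q = go (χ G) refl
  where
  go : ∀ k → χ G ≡ k → k < χ H → ∃ (Distinguishes (suc q) G H)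
  go zero    χG _  = contradiction χG (χ≢0 G)
  go (suc k) χG lt =
    let X , arrows , L , local = sparseChromaticArrow (order H) (order G) q k
    in toGraph X ,
       toGraph-arrows X (λ c →
         let i , κ = arrows c in i , clique-copy X G κ (subst (Colourable G) χG (χ-colouring G))) ,
       λ arrowsH →
         let i , w , _ , edges = layer-copy X L arrowsH
             g , proper = local i w
         in ℕ.<⇒≱ lt (χ-least H (g , λ u v e → proper u v (edges u v e)))

edgeless-copy : ∀ G {q s} (f : Vertex G → Fin 1) → Proper G f → #colour₁ G f ≡ suc s →
  {c : Fin (suc s) → Fin (suc s) → Fin q} (i : Fin q) → MonochromaticCopy (independent s) G c i
edgeless-copy G f proper size i = record
  { vertex     = λ v → cast size (proj₁ ranking v (cong toℕ (only-zero (f v))))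
  ; injective  = λ eq → proj₂ ranking _ _ (cast-injective size eq)
  ; adjacent   = edgeless
  ; monochrome = λ e → contradiction e edgeless
  }
  where
  ranking = rank (λ v → toℕ (f v) ≟ 0) {order G} id

  only-zero : ∀ (x : Fin 1) → x ≡ zero
  only-zero zero = refl

  edgeless : ∀ {u v} → ¬ Graph._~_ G u v
  edgeless {u} {v} e = proper u v e (trans (only-zero (f u)) (sym (only-zero (f v))))

  cast-injective : ∀ {m n} .(eq : m ≡ n) {x y : Fin m} → cast eq x ≡ cast eq y → x ≡ y
  cast-injective eq {x} {y} same = toℕ-injective
    (trans (sym (toℕ-cast eq x)) (trans (cong toℕ same) (toℕ-cast eq y)))

-- With one colour, `a` is the number of vertices, so the edgeless graph on `a G` vertices contains
-- `G` but is too small for `H`.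
distinguish-edgeless : ∀ G H q → χ G ≡ 1 → χ H ≡ 1 → a G < a H → ∃ (Distinguishes (suc q) G H)
distinguish-edgeless G H q χG χH lt = go (a G) refl
  where
  go : ∀ s → a G ≡ s → ∃ (Distinguishes (suc q) G H)
  go zero    aG = contradiction aG (a≢0 G χG)
  go (suc s) aG =
    toGraph (independent s) ,
    toGraph-arrows (independent s) (λ c →
      let f , proper , size = a-colouring G χG
      in zero , edgeless-copy G f proper (trans size aG) zero) ,
    λ arrowsH →
      let _ , w , w-inj , edges = layer-copy (independent s) (proj₁ (independent-layering 0 s (λ _ → 0))) arrowsH
      in ℕ.<⇒≱ lt (≤-trans (a-least H χH (λ _ → zero) (λ u v e → contradiction (edges u v e) id))
           (≤-trans (count-≤ (λ _ → 0 ≟ 0) (λ v _ → w v) (λ _ _ → w-inj) id id)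
                    (≤-reflexive (sym aG))))

module _ {q : ℕ} (s : ℕ) where
  -- The vertices after the first are split into `suc q` blocks of size `s`, and the first is added
  -- to block `zero`; so no block exceeds `suc s`. The slot `zero` of `position` is left free for
  -- this extra vertex.
  balanced : Fin (suc (suc q * s)) → Fin (suc q)
  balanced zero    = zero
  balanced (suc x) = proj₁ (remQuot s x)

  position : Fin (suc (suc q * s)) → Fin (suc s)
  position zero    = zero
  position (suc x) = suc (proj₂ (remQuot {suc q} s x))

  position-injective : ∀ x y → balanced x ≡ balanced y → position x ≡ position y → x ≡ y
  position-injective zero    zero    _  _   = refl
  position-injective (suc x) (suc y) eq eq′ = cong suc
    (trans (sym (combine-remQuot {suc q} s x))
      (trans (cong₂ combine eq (suc-injective eq′)) (combine-remQuot {suc q} s y)))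

module _ {n m q k s : ℕ} (J : JoinArrow {suc q} (λ _ → k) m n (suc (suc q * s)) (suc s)) where
  open JoinArrow J using (layering; local; arrow)
  open Join (JoinArrow.base J) (suc (suc q * s))

  join-arrows : ∀ G → order G ≡ m → (f : Vertex G → Fin (suc (suc k))) → Proper G f →
    #colour₁ G f ≤ suc s → toGraph join ⟶⟨ suc q ⟩ G
  join-arrows G refl f proper few = toGraph-arrows join found
    where
    found : (c : Colouring join (suc q)) → ∃[ i ] MonochromaticCopy join G (Colouring.colour c) i
    found c with arrow c
    ... | inj₁ (i , κ) = i , clique-copy join G κ (f , proper)
    ... | inj₂ S       = Star.hue S , star-copy G c S f proper few

  -- The vertices of colour `zero` are joined vertices belonging to the single layer `i`, where
  -- `position` is injective.
  join-arrows⁻¹ : ∀ H → order H ≡ n → toGraph join ⟶⟨ suc q ⟩ H →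
    Σ[ g ∈ (Vertex H → Fin (suc (suc k))) ] (Proper H g × #colour₁ H g ≤ suc s)
  join-arrows⁻¹ H refl arrowsH with layer-copy join (join-layering layering (balanced s)) arrowsH
  ... | i , w , w-inj , edges with join-colourable layering (balanced s) i (local i) w
  ...   | g , proper , zeros =
    g , (λ u v e → proper u v (edges u v e)) , count-≤ (λ v → toℕ (g v) ≟ 0) slot slot-injective id id
    where
    apex : ∀ v → toℕ (g v) ≡ 0 → Σ[ x ∈ Fin (suc (suc q * s)) ] (w v ≡ inj₂ x × balanced s x ≡ i)
    apex v eq = zeros v (toℕ-injective eq)

    slot : ∀ v → toℕ (g v) ≡ 0 → Fin (suc s)
    slot v eq = position {q} s (proj₁ (apex v eq))

    slot-injective : ∀ {x y} p p′ → slot x p ≡ slot y p′ → x ≡ y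
    slot-injective {x} {y} p p′ eq with apex x p | apex y p′
    ... | x′ , at , hue | y′ , at′ , hue′ =
      w-inj (trans at (trans (cong inj₂ (position-injective {q} s x′ y′ (trans hue (sym hue′)) eq)) (sym at′)))

distinguish-a : ∀ G H q k → χ G ≡ suc (suc k) → χ H ≡ suc (suc k) → a G < a H →
                ∃ (Distinguishes (suc q) G H)
distinguish-a G H q k χG χH lt = go (a G) refl
  where
  below : ∀ j → SparseArrowBelow (order H) (order G) {suc q} (λ _ → k) j
  below j = sparseArrowBelow (order H) (order G) _ (λ _ → k) zero ≤-refl j k refl

  go : ∀ s → a G ≡ s → ∃ (Distinguishes (suc q) G H)
  go zero    aG = contradiction aG (a≢0 G χG)
  go (suc s) aG =
    -- With `suc s` equal to `a G`, this many joined vertices force `a G` of them to share an entry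
    -- of the colour vector, while `balanced` puts at most `a G` into each layer.
    let J = joinArrow (order H) (order G) (λ _ → k) zero (suc (suc q * s)) s ≤-refl below
        f , proper , size = a-colouring G χG
    in _ , join-arrows J G refl f proper (≤-reflexive (trans size aG)) ,
       λ arrowsH →
         let g , proper′ , few = join-arrows⁻¹ J H refl arrowsH
         in ℕ.<⇒≱ lt (≤-trans (a-least H χH g proper′) (≤-trans few (≤-reflexive (sym aG))))

distinguish : ∀ G H q → a G < a H → ∃ (Distinguishes (suc q) G H) ⊎ ∃ (Distinguishes (suc q) H G)
distinguish G H q lt = compare (ℕ.<-cmp (χ G) (χ H))
  where
  same-χ : ∀ k → χ G ≡ k → χ H ≡ k → ∃ (Distinguishes (suc q) G H)
  same-χ zero          χG _  = contradiction χG (χ≢0 G)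
  same-χ (suc zero)    χG χH = distinguish-edgeless G H q χG χH lt
  same-χ (suc (suc k)) χG χH = distinguish-a G H q k χG χH lt

  compare : Tri (χ G < χ H) (χ G ≡ χ H) (χ H < χ G) →
            ∃ (Distinguishes (suc q) G H) ⊎ ∃ (Distinguishes (suc q) H G)
  compare (tri< χ< _ _) = inj₁ (distinguish-χ G H q χ<)
  compare (tri> _ _ χ>) = inj₂ (distinguish-χ H G q χ>)
  compare (tri≈ _ χ≡ _) = inj₁ (same-χ (χ G) refl (sym χ≡))

theorem8 : (G H : Graph) → a G < a H →
    (q : ℕ) → 2 ≤ q → ¬ RamseyEquivalent q G H
theorem8 G H lt (suc q) _ equivalent = refute (distinguish G H q lt)
  where
  refute : ¬ (∃ (Distinguishes (suc q) G H) ⊎ ∃ (Distinguishes (suc q) H G))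
  refute (inj₁ (F , arrowsG , ¬arrowsH)) = ¬arrowsH (Equivalence.to (equivalent F) arrowsG)
  refute (inj₂ (F , arrowsH , ¬arrowsG)) = ¬arrowsG (Equivalence.from (equivalent F) arrowsH)
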